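{- Let $n\ge1$ and $d,k\ge0$. There is a bijection between the set of bi-increasing permutations $\pi\in{\cal S}_n$ with ${\sf des}(\pi)=d$ and ${\sf ddes}(\pi)=k$ and the set of $2$-Motzkin paths of length $n$ that have exactly $d$ up-steps, have no broken step of height $0$, and for which the sum of the heights of all steps equals $k$.
   Context: Permutations $\pi\in{\cal S}_n$ are written as words $\pi_1\cdots\pi_n$. An excedance of $\pi$ is an integer $i\in[n-1]$ with $\pi_i>i$; ${\sf E}(\pi)$ is the set of excedances, ${\sf dexc}(\pi)=\sum_{i\in{\sf E}(\pi)}(\pi_i-i)$, and ${\sf inv}(\pi)$ is the number of pairs $i<j$ with $\pi_i>\pi_j$. A permutation is bi-increasing if ${\sf inv}(\pi)={\sf dexc}(\pi)$. A descent is an $i\in[n-1]$ with $\pi_i>\pi_{i+1}$; ${\sf D}(\pi)$ is the set of descents, ${\sf des}(\pi)=|{\sf D}(\pi)|$ and ${\sf ddes}(\pi)=\sum_{i\in{\sf D}(\pi)}(\pi_i-\pi_{i+1})$. A $2$-Motzkin path of length $n$ is a lattice path from $(0,0)$ to $(n,0)$ never going below the $x$-axis, each step being an up-step $[1,1]$, a down-step $[1,-1]$, or one of two distinguishable kinds of horizontal step $[1,0]$, called solid and broken. The height of a step is the ordinate of its starting point. -}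

module Defs where

open import Data.Bool using (Bool; true; false; _∧_; not; if_then_else_)
open import Data.Nat using (ℕ; zero; suc; _+_; _∸_; _≡ᵇ_; _<ᵇ_; _≤ᵇ_)
open import Data.List using (List; []; _∷_; length)
open import Data.Bool.ListAction using (all; any)

-- Permutations in S_n are words π₁⋯πₙ, given as lists of naturals
-- (values 1..n, positions 1-indexed).

inRange : ℕ → List ℕ → Bool
inRange n = all (λ x → (1 ≤ᵇ x) ∧ (x ≤ᵇ n))

distinct : List ℕ → Bool
distinct [] = true
distinct (x ∷ xs) = not (any (λ y → x ≡ᵇ y) xs) ∧ distinct xs

isPerm : ℕ → List ℕ → Bool
isPerm n w = (length w ≡ᵇ n) ∧ inRange n w ∧ distinct w

countLess : ℕ → List ℕ → ℕ
countLess x [] = 0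
countLess x (y ∷ ys) = (if y <ᵇ x then 1 else 0) + countLess x ys

inv : List ℕ → ℕ
inv [] = 0
inv (x ∷ xs) = countLess x xs + inv xs

dexcFrom : ℕ → ℕ → List ℕ → ℕ
dexcFrom n i [] = 0
dexcFrom n i (x ∷ xs) =
  (if (i <ᵇ n) ∧ (i <ᵇ x) then x ∸ i else 0) + dexcFrom n (suc i) xs

dexc : List ℕ → ℕ
dexc w = dexcFrom (length w) 1 w

isBiIncreasing : List ℕ → Bool
isBiIncreasing w = inv w ≡ᵇ dexc w

des : List ℕ → ℕ
des [] = 0
des (x ∷ []) = 0
des (x ∷ y ∷ ys) = (if y <ᵇ x then 1 else 0) + des (y ∷ ys)

ddes : List ℕ → ℕ
ddes [] = 0
ddes (x ∷ []) = 0
ddes (x ∷ y ∷ ys) = (if y <ᵇ x then x ∸ y else 0) + ddes (y ∷ ys)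

data Step : Set where
  up down solid broken : Step

validFrom : ℕ → List Step → Bool
validFrom h [] = h ≡ᵇ 0
validFrom h (up ∷ s) = validFrom (suc h) s
validFrom zero (down ∷ s) = false
validFrom (suc h) (down ∷ s) = validFrom h s
validFrom h (solid ∷ s) = validFrom h s
validFrom h (broken ∷ s) = validFrom h s

isMotzkin2 : List Step → Bool
isMotzkin2 = validFrom 0

numUp : List Step → ℕ
numUp [] = 0
numUp (up ∷ s) = suc (numUp s)
numUp (_ ∷ s) = numUp s

noBrokenAt0From : ℕ → List Step → Bool
noBrokenAt0From h [] = true
noBrokenAt0From h (up ∷ s) = noBrokenAt0From (suc h) s
noBrokenAt0From h (down ∷ s) = noBrokenAt0From (h ∸ 1) s
noBrokenAt0From h (solid ∷ s) = noBrokenAt0From h s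
noBrokenAt0From zero (broken ∷ s) = false
noBrokenAt0From (suc h) (broken ∷ s) = noBrokenAt0From (suc h) s

-- sum of heights (ordinates of starting points) of all steps
heightSumFrom : ℕ → List Step → ℕ
heightSumFrom h [] = 0
heightSumFrom h (up ∷ s) = h + heightSumFrom (suc h) s
heightSumFrom h (down ∷ s) = h + heightSumFrom (h ∸ 1) s
heightSumFrom h (solid ∷ s) = h + heightSumFrom h s
heightSumFrom h (broken ∷ s) = h + heightSumFrom h s

heightSum : List Step → ℕ
heightSum = heightSumFrom 0

-- The two sets of the theorem (as subtypes cut out by Boolean predicates,
-- so membership proofs T b are proof-irrelevant)

biIncPermPred : ℕ → ℕ → ℕ → List ℕ → Bool
biIncPermPred n d k w =
  isPerm n w ∧ isBiIncreasing w ∧ (des w ≡ᵇ d) ∧ (ddes w ≡ᵇ k)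

motzkinPred : ℕ → ℕ → ℕ → List Step → Bool
motzkinPred n d k p =
  (length p ≡ᵇ n) ∧ isMotzkin2 p ∧ (numUp p ≡ᵇ d)
    ∧ noBrokenAt0From 0 p ∧ (heightSum p ≡ᵇ k)

{-# OPTIONS --safe #-}
module Submission where

-- Read a permutation by values: step v of the path is up if v is the bottom of
-- a descent, down if it is the top of one, and otherwise solid or broken as v is
-- or is not a left-to-right maximum.  The height at v is the number of descents
-- straddling v, so the heights add up to ddes.
-- Bi-increasing words are those in which, from left to right, every letter is
-- either a new maximum or the smallest value not yet used: a new maximum x at
-- position i is followed by exactly x - i smaller letters, whereas any other
-- letter contributes more to inv than to dexc, unless it is the smallest unused
-- value and contributes to neither.
-- Hence the non-maxima leave in the order in which their values were passed
-- over, and the word is recovered from the path with a queue of blocks: up opens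
-- a block, broken extends the last one, solid outputs a maximum, and down
-- outputs a maximum followed by the first block.

open import Defs
open import Data.Bool using (Bool; true; false; T; _∧_; not; if_then_else_)
open import Data.Bool.ListAction using (any)
open import Data.Bool.Properties using (T-∧; T-irrelevant; ¬-not)
open import Data.List using (List; []; _∷_; [_]; _++_; _∷ʳ_; length; map; initLast; _∷ʳ′_)
open import Data.List.Membership.Propositional using (_∈_)
open import Data.List.Membership.Propositional.Properties using (∈-∃++; ∈-++⁻; ∈-++⁺ˡ; ∈-++⁺ʳ)
open import Data.List.Properties using (++-assoc; ++-cancelˡ; ++-identityʳ; length-++; length-++-sucʳ; ∷-injective; ∷-injectiveʳ; ∷ʳ-injective; ∷ʳ-++)
open import Data.List.Relation.Binary.Permutation.Propositional using (_↭_; refl; prep; swap; trans; ↭-sym; ↭-reflexive; ↭⇒↭ₛ)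
open import Data.List.Relation.Binary.Permutation.Propositional.Properties using (shift; drop-∷; ↭-length; ∈-resp-↭; All-resp-↭; ↭-empty-inv)
open import Data.List.Relation.Unary.All using (All; []; _∷_)
import Data.List.Relation.Unary.All as All
import Data.List.Relation.Unary.All.Properties as All
open import Data.List.Relation.Unary.AllPairs using (AllPairs; []; _∷_)
import Data.List.Relation.Unary.AllPairs as AllPairs
import Data.List.Relation.Unary.AllPairs.Properties as AllPairs
open import Data.List.Relation.Unary.Any using (here; there)
import Data.List.Relation.Unary.Any as Any
open import Data.List.Relation.Unary.Any.Properties using (any⁺; any⁻)
open import Data.List.Relation.Unary.Unique.Propositional using (Unique)
open import Data.Nat using (ℕ; zero; suc; pred; _+_; _∸_; _≥_; _≤_; _<_; _<ᵇ_; _≡ᵇ_; _≤ᵇ_; z≤n; s≤s)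
open import Data.Nat.ListAction using (sum)
open import Data.Nat.Properties
open import Data.Nat.Tactic.RingSolver using (solve-∀)
open import Data.Product using (Σ; ∃; ∃₂; _×_; _,_; proj₁; proj₂)
open import Data.Sum using (inj₁; inj₂)
open import Function.Bundles using (_↔_; mk↔ₛ′; Equivalence)
open import Relation.Binary.PropositionalEquality using (_≡_; _≢_; refl; sym; ≢-sym; cong; cong₂; subst; setoid; module ≡-Reasoning)
import Relation.Binary.PropositionalEquality as ≡
open import Relation.Nullary using (¬_; yes; no; contradiction)
open import Data.List.Relation.Binary.Permutation.Setoid.Properties (setoid ℕ) using (Unique-resp-↭)

-- Reading a path with a queue of blocks

Block : Set
Block = ℕ × List ℕ

flatten : List Block → List ℕ
flatten [] = []
flatten ((b , B) ∷ Bs) = b ∷ B ++ flatten Bs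

-- Reads Bs m p w: the values up to m have been treated, those still to be output
-- are queued in Bs, and following p outputs w.
data Reads : List Block → ℕ → List Step → List ℕ → Set where
  end    : ∀ {m} → Reads [] m [] []
  up     : ∀ {Bs m p w} → Reads (Bs ∷ʳ (suc m , [])) (suc m) p w → Reads Bs m (up ∷ p) w
  broken : ∀ {Bs b B m p w} → Reads (Bs ∷ʳ (b , B ∷ʳ suc m)) (suc m) p w →
           Reads (Bs ∷ʳ (b , B)) m (broken ∷ p) w
  solid  : ∀ {Bs m p w} → Reads Bs (suc m) p w → Reads Bs m (solid ∷ p) (suc m ∷ w)
  down   : ∀ {Bs b B m p w} → Reads Bs (suc m) p w →
           Reads ((b , B) ∷ Bs) m (down ∷ p) (suc m ∷ b ∷ B ++ w)

flatten-∷ʳ : ∀ Bs b B → flatten (Bs ∷ʳ (b , B)) ≡ flatten Bs ++ b ∷ B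
flatten-∷ʳ [] b B = cong (b ∷_) (++-identityʳ B)
flatten-∷ʳ ((c , C) ∷ Bs) b B =
  cong (c ∷_) (≡.trans (cong (C ++_) (flatten-∷ʳ Bs b B)) (sym (++-assoc C (flatten Bs) (b ∷ B))))

flatten-extend : ∀ Bs b B x → flatten (Bs ∷ʳ (b , B ∷ʳ x)) ≡ flatten (Bs ∷ʳ (b , B)) ∷ʳ x
flatten-extend Bs b B x = begin
  flatten (Bs ∷ʳ (b , B ∷ʳ x))     ≡⟨ flatten-∷ʳ Bs b (B ∷ʳ x) ⟩
  flatten Bs ++ (b ∷ B) ∷ʳ x       ≡⟨ ++-assoc (flatten Bs) (b ∷ B) [ x ] ⟨
  (flatten Bs ++ b ∷ B) ∷ʳ x       ≡⟨ cong (_∷ʳ x) (flatten-∷ʳ Bs b B) ⟨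
  flatten (Bs ∷ʳ (b , B)) ∷ʳ x     ∎
  where open ≡-Reasoning

length-∷ʳ : ∀ {A : Set} (xs : List A) x → length (xs ∷ʳ x) ≡ suc (length xs)
length-∷ʳ [] x = refl
length-∷ʳ (y ∷ xs) x = cong suc (length-∷ʳ xs x)

-- Path and word determine each other

Reads-functional : ∀ {Bs m p w w′} → Reads Bs m p w → Reads Bs m p w′ → w ≡ w′
Reads-functional r r′ = go r r′ refl
  where
  -- The queues are kept apart and joined by an equation, because two indices of the form
  -- `Bs ∷ʳ (b , B)` in `broken` do not unify by pattern matching.
  go : ∀ {Bs Bs′ m p w w′} → Reads Bs m p w → Reads Bs′ m p w′ → Bs ≡ Bs′ → w ≡ w′
  go end end _ = refl
  go (up r) (up r′) refl = go r r′ refl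
  go (broken {Bs} r) (broken {Bs′} r′) eq with ∷ʳ-injective Bs Bs′ eq
  ... | refl , refl = go r r′ refl
  go (solid r) (solid r′) refl = cong (_ ∷_) (go r r′ refl)
  go (down {b = b} {B} r) (down r′) refl = cong (λ w → _ ∷ b ∷ B ++ w) (go r r′ refl)

-- Only the first letter is constrained, since smaller values may follow it. It marks where a
-- preceding block of values up to `m` ends.
data Above (m : ℕ) : List ℕ → Set where
  []  : Above m []
  _∷_ : ∀ {x} → m < x → ∀ w → Above m (x ∷ w)

Above-weaken : ∀ {m w} → Above (suc m) w → Above m w
Above-weaken [] = []
Above-weaken (m<x ∷ w) = <⇒≤ m<x ∷ w

Reads⇒Above : ∀ {Bs m p w} → Reads Bs m p w → Above m w
Reads⇒Above end = []
Reads⇒Above (up r) = Above-weaken (Reads⇒Above r)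
Reads⇒Above (broken r) = Above-weaken (Reads⇒Above r)
Reads⇒Above (solid r) = ≤-refl ∷ _
Reads⇒Above (down r) = ≤-refl ∷ _

Reads-[] : ∀ {Bs m p} → Reads Bs m p [] → Bs ≡ []
Reads-[] end = refl
Reads-[] (up {Bs} r) with Bs | Reads-[] r
... | [] | ()
... | _ ∷ _ | ()
Reads-[] (broken {Bs} r) with Bs | Reads-[] r
... | [] | ()
... | _ ∷ _ | ()

∷ʳ≢[] : ∀ {A : Set} (xs : List A) {x} → xs ∷ʳ x ≢ []
∷ʳ≢[] [] ()
∷ʳ≢[] (_ ∷ _) ()

¬Above-head : ∀ {x w} → ¬ Above x (x ∷ w)
¬Above-head (x<x ∷ _) = <-irrefl refl x<x

-- The first letter above `m` starts the remainder, so the end of a popped block is visible in the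
-- word.
++-Above-injective : ∀ {m B B′ w w′} → All (_≤ m) B → All (_≤ m) B′ → Above m w → Above m w′ →
                     B ++ w ≡ B′ ++ w′ → B ≡ B′ × w ≡ w′
++-Above-injective [] [] _ _ eq = refl , eq
++-Above-injective [] (x≤m ∷ _) (m<x ∷ _) _ refl = contradiction x≤m (<⇒≱ m<x)
++-Above-injective (x≤m ∷ _) [] _ (m<x ∷ _) refl = contradiction x≤m (<⇒≱ m<x)
++-Above-injective (_ ∷ B≤) (_ ∷ B′≤) aw aw′ eq with ∷-injective eq
... | refl , eq′ with ++-Above-injective B≤ B′≤ aw aw′ eq′
... | refl , refl = refl , refl

Bounded : ℕ → List Block → Set
Bounded m Bs = All (_≤ m) (flatten Bs)

All-≤-suc : ∀ {m xs} → All (_≤ m) xs → All (_≤ suc m) xs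
All-≤-suc = All.map m≤n⇒m≤1+n

Bounded-up : ∀ {m} Bs → Bounded m Bs → Bounded (suc m) (Bs ∷ʳ (suc m , []))
Bounded-up {m} Bs bd = subst (All _) (sym (flatten-∷ʳ Bs (suc m) [])) (All.∷ʳ⁺ (All-≤-suc bd) ≤-refl)

Bounded-broken : ∀ {m} Bs b B → Bounded m (Bs ∷ʳ (b , B)) → Bounded (suc m) (Bs ∷ʳ (b , B ∷ʳ suc m))
Bounded-broken {m} Bs b B bd =
  subst (All _) (sym (flatten-extend Bs b B (suc m))) (All.∷ʳ⁺ (All-≤-suc bd) ≤-refl)

Bounded-down : ∀ {m b B} Bs → Bounded m ((b , B) ∷ Bs) → Bounded (suc m) Bs
Bounded-down {B = B} Bs (_ ∷ bd) = All-≤-suc (All.++⁻ʳ B bd)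

-- The blocks themselves must be recovered along with the path: they are what
-- tells an up step from a broken one.
Reads-injective : ∀ {Bs Bs′ m p p′ w w′} → Bounded m Bs → flatten Bs ≡ flatten Bs′ →
                  Reads Bs m p w → Reads Bs′ m p′ w′ → w ≡ w′ → p ≡ p′ × Bs ≡ Bs′
Reads-injective bd fe end end we = refl , refl
Reads-injective bd fe end (up {Bs} r) refl = contradiction (Reads-[] r) (∷ʳ≢[] Bs)
Reads-injective bd fe end (broken {Bs} r) refl = contradiction (Reads-[] r) (∷ʳ≢[] Bs)
Reads-injective bd fe (up {Bs} r) end refl = contradiction (Reads-[] r) (∷ʳ≢[] Bs)
Reads-injective bd fe (broken {Bs} r) end refl = contradiction (Reads-[] r) (∷ʳ≢[] Bs)
-- After `up` or `broken` the value `suc m` is queued and the next letter exceeds it, whereas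
-- `solid` and `down` write `suc m` at once.
Reads-injective bd fe (up r) (solid _) refl = contradiction (Reads⇒Above r) ¬Above-head
Reads-injective bd fe (up r) (down _) refl = contradiction (Reads⇒Above r) ¬Above-head
Reads-injective bd fe (broken r) (solid _) refl = contradiction (Reads⇒Above r) ¬Above-head
Reads-injective bd fe (broken r) (down _) refl = contradiction (Reads⇒Above r) ¬Above-head
Reads-injective bd fe (solid _) (up r) refl = contradiction (Reads⇒Above r) ¬Above-head
Reads-injective bd fe (solid _) (broken r) refl = contradiction (Reads⇒Above r) ¬Above-head
Reads-injective bd fe (down _) (up r) refl = contradiction (Reads⇒Above r) ¬Above-head
Reads-injective bd fe (down _) (broken r) refl = contradiction (Reads⇒Above r) ¬Above-head
Reads-injective {m = m} bd fe (up {Bs} r) (up {Bs′} r′) we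
  with Reads-injective (Bounded-up Bs bd)
         (≡.trans (flatten-∷ʳ Bs (suc m) []) (≡.trans (cong (_∷ʳ suc m) fe) (sym (flatten-∷ʳ Bs′ (suc m) [])))) r r′ we
... | refl , eq = refl , proj₁ (∷ʳ-injective Bs Bs′ eq)
Reads-injective {m = m} bd fe (up {Bs} r) (broken {Bs′} {b} {B} r′) we
  with Reads-injective (Bounded-up Bs bd)
         (≡.trans (flatten-∷ʳ Bs (suc m) []) (≡.trans (cong (_∷ʳ suc m) fe) (sym (flatten-extend Bs′ b B (suc m))))) r r′ we
-- `up` leaves a last block with a single value, `broken` one with at least two.
... | _ , eq = contradiction (sym (cong proj₂ (proj₂ (∷ʳ-injective Bs Bs′ eq)))) (∷ʳ≢[] B)
Reads-injective {m = m} bd fe (broken {Bs} {b} {B} r) (up {Bs′} r′) we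
  with Reads-injective (Bounded-broken Bs b B bd)
         (≡.trans (flatten-extend Bs b B (suc m)) (≡.trans (cong (_∷ʳ suc m) fe) (sym (flatten-∷ʳ Bs′ (suc m) [])))) r r′ we
... | _ , eq = contradiction (cong proj₂ (proj₂ (∷ʳ-injective Bs Bs′ eq))) (∷ʳ≢[] B)
Reads-injective {m = m} bd fe (broken {Bs} {b} {B} r) (broken {Bs′} {b′} {B′} r′) we
  with Reads-injective (Bounded-broken Bs b B bd)
         (≡.trans (flatten-extend Bs b B (suc m)) (≡.trans (cong (_∷ʳ suc m) fe) (sym (flatten-extend Bs′ b′ B′ (suc m))))) r r′ we
... | refl , eq with ∷ʳ-injective Bs Bs′ eq
... | refl , eq′ with cong proj₁ eq′ | ∷ʳ-injective B B′ (cong proj₂ eq′)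
... | refl | refl , _ = refl , refl
Reads-injective bd fe (solid r) (solid r′) we
  with Reads-injective (All-≤-suc bd) fe r r′ (∷-injectiveʳ we)
... | refl , refl = refl , refl
-- The letter after `suc m` is a queued value, at most `m`, if the step is `down`, but exceeds
-- `suc m` if it is `solid`.
Reads-injective bd fe (solid r) (down {Bs} r′) refl with subst (All _) fe bd | Reads⇒Above r
... | b≤m ∷ _ | m<b ∷ _ = contradiction (m≤n⇒m≤1+n b≤m) (<⇒≱ m<b)
Reads-injective (b≤m ∷ _) fe (down r) (solid r′) refl with Reads⇒Above r′
... | m<b ∷ _ = contradiction (m≤n⇒m≤1+n b≤m) (<⇒≱ m<b)
Reads-injective bd@(_ ∷ bd′) fe (down {Bs} {b} {B} r) (down {Bs′} {b′} {B′} r′) we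
  with ∷-injective (∷-injectiveʳ we) | subst (All _) fe bd
... | refl , we′ | _ ∷ bd″
  with ++-Above-injective (All.++⁻ˡ B bd′) (All.++⁻ˡ B′ bd″)
         (Above-weaken (Reads⇒Above r)) (Above-weaken (Reads⇒Above r′)) we′
... | refl , refl
  with Reads-injective (Bounded-down {b = b} {B} Bs bd) (++-cancelˡ B _ _ (∷-injectiveʳ fe)) r r′ refl
... | refl , refl = refl , refl

-- Height as the length of the queue

path⇒Reads : ∀ {h} Bs m p → length Bs ≡ h → T (validFrom h p) → T (noBrokenAt0From h p) → ∃ (Reads Bs m p)
path⇒Reads {zero} [] m [] eq v nb = [] , end
path⇒Reads Bs m (up ∷ p) eq v nb =
  let w , r = path⇒Reads (Bs ∷ʳ (suc m , [])) (suc m) p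
                (≡.trans (length-∷ʳ Bs (suc m , [])) (cong suc eq)) v nb
  in w , up r
-- Not going below the axis means that a down-step always finds a block to output.
path⇒Reads {suc h} (_ ∷ Bs) m (down ∷ p) eq v nb =
  let w , r = path⇒Reads Bs (suc m) p (suc-injective eq) v nb in _ , down r
path⇒Reads {zero} Bs m (solid ∷ p) eq v nb =
  let w , r = path⇒Reads Bs (suc m) p eq v nb in _ , solid r
path⇒Reads {suc h} Bs m (solid ∷ p) eq v nb =
  let w , r = path⇒Reads Bs (suc m) p eq v nb in _ , solid r
-- Positive height provides a last block to extend; this is what excluding broken steps at height 0
-- is for.
path⇒Reads {suc h} Bs m (broken ∷ p) eq v nb with initLast Bs
... | Bs′ ∷ʳ′ (b , B) =
  let w , r = path⇒Reads (Bs′ ∷ʳ (b , B ∷ʳ suc m)) (suc m) p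
                (≡.trans (length-∷ʳ Bs′ (b , B ∷ʳ suc m)) (≡.trans (sym (length-∷ʳ Bs′ (b , B))) eq)) v nb
  in w , broken r

Reads⇒path : ∀ {h Bs m p w} → length Bs ≡ h → Reads Bs m p w → T (validFrom h p) × T (noBrokenAt0From h p)
Reads⇒path {zero} eq end = _ , _
Reads⇒path eq (up {Bs} {m} r) = Reads⇒path (≡.trans (length-∷ʳ Bs (suc m , [])) (cong suc eq)) r
Reads⇒path {zero} eq (broken {Bs} {b} {B} r) =
  contradiction (≡.trans (sym (length-∷ʳ Bs (b , B))) eq) 1+n≢0
Reads⇒path {suc h} eq (broken {Bs} {b} {B} {m} r) =
  Reads⇒path (≡.trans (length-∷ʳ Bs (b , B ∷ʳ suc m)) (≡.trans (sym (length-∷ʳ Bs (b , B))) eq)) r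
Reads⇒path {zero} eq (solid r) = Reads⇒path eq r
Reads⇒path {suc h} eq (solid r) = Reads⇒path eq r
Reads⇒path {suc h} eq (down r) = Reads⇒path (suc-injective eq) r

-- Descents

<ᵇ-true : ∀ {m n} → m < n → (m <ᵇ n) ≡ true
<ᵇ-true {m} {n} m<n with m <ᵇ n | <⇒<ᵇ m<n
... | true | _ = refl

<ᵇ-false : ∀ {m n} → n ≤ m → (m <ᵇ n) ≡ false
<ᵇ-false {m} {n} n≤m = ¬-not λ eq → <⇒≱ (<ᵇ⇒< m n (subst T (sym eq) _)) n≤m

des-ascent : ∀ {x y} w → x ≤ y → des (x ∷ y ∷ w) ≡ des (y ∷ w)
des-ascent w x≤y rewrite <ᵇ-false x≤y = refl

des-descent : ∀ {x y} w → y < x → des (x ∷ y ∷ w) ≡ suc (des (y ∷ w))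
des-descent w y<x rewrite <ᵇ-true y<x = refl

ddes-ascent : ∀ {x y} w → x ≤ y → ddes (x ∷ y ∷ w) ≡ ddes (y ∷ w)
ddes-ascent w x≤y rewrite <ᵇ-false x≤y = refl

ddes-descent : ∀ {x y} w → y < x → ddes (x ∷ y ∷ w) ≡ x ∸ y + ddes (y ∷ w)
ddes-descent w y<x rewrite <ᵇ-true y<x = refl

des-ddes-∷-Above : ∀ {m x w} → x ≤ m → Above m w → des (x ∷ w) ≡ des w × ddes (x ∷ w) ≡ ddes w
des-ddes-∷-Above x≤m [] = refl , refl
des-ddes-∷-Above x≤m (m<y ∷ w) = let x≤y = ≤-trans x≤m (<⇒≤ m<y) in des-ascent w x≤y , ddes-ascent w x≤y

-- There is no descent inside an increasing block or on leaving it for a larger letter, so popping a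
-- block creates only the descent that enters it.
des-ddes-run : ∀ {m B w} → All (_≤ m) B → AllPairs _<_ B → Above m w →
               des (B ++ w) ≡ des w × ddes (B ++ w) ≡ ddes w
des-ddes-run [] [] aw = refl , refl
des-ddes-run (x≤m ∷ []) _ aw = des-ddes-∷-Above x≤m aw
des-ddes-run {B = x ∷ y ∷ B} {w} (_ ∷ B≤) ((x<y ∷ _) ∷ B<) aw =
  let d , dd = des-ddes-run B≤ B< aw in
  ≡.trans (des-ascent (B ++ w) (<⇒≤ x<y)) d , ≡.trans (ddes-ascent (B ++ w) (<⇒≤ x<y)) dd

AllPairs-++⁻ : ∀ {R : ℕ → ℕ → Set} xs {ys} → AllPairs R (xs ++ ys) → AllPairs R xs × AllPairs R ys
AllPairs-++⁻ [] rs = [] , rs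
AllPairs-++⁻ (x ∷ xs) (r ∷ rs) = let a , b = AllPairs-++⁻ xs rs in (All.++⁻ˡ xs r ∷ a) , b

∷ʳ-sorted : ∀ {m xs} → All (_≤ m) xs → AllPairs _<_ xs → AllPairs _<_ (xs ∷ʳ suc m)
∷ʳ-sorted xs≤ xs< = AllPairs.++⁺ xs< ([] ∷ []) (All.map (λ x≤m → s≤s x≤m ∷ []) xs≤)

-- The head of each queued block will be the bottom of a descent whose top exceeds
-- m; this is what these descents have contributed to ddes up to the value m.
openGaps : ℕ → List Block → ℕ
openGaps m Bs = sum (map (λ B → m ∸ proj₁ B) Bs)

openGaps-∷ʳ : ∀ m Bs b B → openGaps m (Bs ∷ʳ (b , B)) ≡ openGaps m Bs + (m ∸ b)
openGaps-∷ʳ m [] b B = +-identityʳ _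
openGaps-∷ʳ m ((c , C) ∷ Bs) b B =
  ≡.trans (cong (m ∸ c +_) (openGaps-∷ʳ m Bs b B)) (sym (+-assoc (m ∸ c) (openGaps m Bs) (m ∸ b)))

-- Every open gap widens by one when `m` does. The total gain is the height of the step for `suc m`,
-- which is how heights enter `ddes`.
openGaps-suc : ∀ {m} Bs → Bounded m Bs → openGaps (suc m) Bs ≡ length Bs + openGaps m Bs
openGaps-suc [] _ = refl
openGaps-suc {m} ((b , B) ∷ Bs) (b≤m ∷ bd) = begin
  suc m ∸ b + openGaps (suc m) Bs             ≡⟨ cong₂ _+_ (+-∸-assoc 1 b≤m) (openGaps-suc Bs (All.++⁻ʳ B bd)) ⟩
  suc (m ∸ b) + (length Bs + openGaps m Bs)   ≡⟨ rearrange (m ∸ b) (length Bs) (openGaps m Bs) ⟩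
  suc (length Bs) + (m ∸ b + openGaps m Bs)   ∎
  where
  open ≡-Reasoning
  rearrange : ∀ x y z → suc x + (y + z) ≡ suc y + (x + z)
  rearrange = solve-∀

m+[n+o]≡n+m+o : ∀ m n o → m + (n + o) ≡ n + m + o
m+[n+o]≡n+m+o = solve-∀

-- Each queued block yields one descent when it is popped, and each up-step still ahead opens one
-- more block.
Reads-des : ∀ {Bs m p w} → Bounded m Bs → AllPairs _<_ (flatten Bs) → Reads Bs m p w →
            des w ≡ numUp p + length Bs
Reads-des bd st end = refl
Reads-des bd st (up {Bs} {m} {p} r) =
  ≡.trans (Reads-des (Bounded-up Bs bd) (subst (AllPairs _<_) (sym (flatten-∷ʳ Bs (suc m) [])) (∷ʳ-sorted bd st)) r)
    (≡.trans (cong (numUp p +_) (length-∷ʳ Bs _)) (+-suc (numUp p) (length Bs)))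
Reads-des bd st (broken {Bs} {b} {B} {m} {p} r) =
  ≡.trans (Reads-des (Bounded-broken Bs b B bd) (subst (AllPairs _<_) (sym (flatten-extend Bs b B (suc m))) (∷ʳ-sorted bd st)) r)
    (cong (numUp p +_) (≡.trans (length-∷ʳ Bs _) (sym (length-∷ʳ Bs _))))
Reads-des bd st (solid r) =
  ≡.trans (proj₁ (des-ddes-∷-Above ≤-refl (Reads⇒Above r))) (Reads-des (All-≤-suc bd) st r)
Reads-des {m = m} bd@(b≤m ∷ _) st (down {Bs} {b} {B} {p = p} {w} r) = begin
  des (suc m ∷ b ∷ B ++ w)          ≡⟨ des-descent (B ++ w) (s≤s b≤m) ⟩
  suc (des (b ∷ B ++ w))            ≡⟨ cong suc (proj₁ (des-ddes-run (All.++⁻ˡ (b ∷ B) bd) (proj₁ (AllPairs-++⁻ (b ∷ B) st)) (Above-weaken (Reads⇒Above r)))) ⟩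
  suc (des w)                       ≡⟨ cong suc (Reads-des (Bounded-down {b = b} {B} Bs bd) (proj₂ (AllPairs-++⁻ (b ∷ B) st)) r) ⟩
  suc (numUp p + length Bs)         ≡⟨ +-suc (numUp p) (length Bs) ⟨
  numUp p + suc (length Bs)         ∎
  where open ≡-Reasoning

-- A descent from `t` to a queued `b` has size `(t - m) + (m - b)`: its block adds one to the height
-- of each step for the values `m + 1` to `t`, and `openGaps` holds the rest.
Reads-ddes : ∀ {Bs m p w} → Bounded m Bs → AllPairs _<_ (flatten Bs) → Reads Bs m p w →
             ddes w ≡ heightSumFrom (length Bs) p + openGaps m Bs
Reads-ddes bd st end = refl
Reads-ddes bd st (up {Bs} {m} {p} {w} r) = begin
  ddes w
    ≡⟨ Reads-ddes (Bounded-up Bs bd) (subst (AllPairs _<_) (sym (flatten-∷ʳ Bs (suc m) [])) (∷ʳ-sorted bd st)) r ⟩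
  heightSumFrom (length (Bs ∷ʳ (suc m , []))) p + openGaps (suc m) (Bs ∷ʳ (suc m , []))
    ≡⟨ cong₂ (λ h g → heightSumFrom h p + g) (length-∷ʳ Bs _) (openGaps-∷ʳ (suc m) Bs (suc m) []) ⟩
  H + (openGaps (suc m) Bs + (m ∸ m))
    ≡⟨ cong₂ (λ g z → H + (g + z)) (openGaps-suc Bs bd) (n∸n≡0 m) ⟩
  H + (length Bs + openGaps m Bs + 0)
    ≡⟨ rearrange H (length Bs) (openGaps m Bs) ⟩
  length Bs + H + openGaps m Bs ∎
  where
  open ≡-Reasoning
  H = heightSumFrom (suc (length Bs)) p
  rearrange : ∀ x y z → x + (y + z + 0) ≡ y + x + z
  rearrange = solve-∀
Reads-ddes bd st (broken {Bs} {b} {B} {m} {p} {w} r) = begin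
  ddes w
    ≡⟨ Reads-ddes (Bounded-broken Bs b B bd) (subst (AllPairs _<_) (sym (flatten-extend Bs b B (suc m))) (∷ʳ-sorted bd st)) r ⟩
  heightSumFrom (length (Bs ∷ʳ (b , B ∷ʳ suc m))) p + openGaps (suc m) (Bs ∷ʳ (b , B ∷ʳ suc m))
    -- Extending a block keeps its head, hence its gap.
    ≡⟨ cong₂ (λ h g → heightSumFrom h p + g) (≡.trans (length-∷ʳ Bs _) (sym (length-∷ʳ Bs _)))
         (≡.trans (openGaps-∷ʳ (suc m) Bs b (B ∷ʳ suc m)) (sym (openGaps-∷ʳ (suc m) Bs b B))) ⟩
  H + openGaps (suc m) (Bs ∷ʳ (b , B))
    ≡⟨ cong (H +_) (openGaps-suc (Bs ∷ʳ (b , B)) bd) ⟩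
  H + (length (Bs ∷ʳ (b , B)) + openGaps m (Bs ∷ʳ (b , B)))
    ≡⟨ m+[n+o]≡n+m+o H (length (Bs ∷ʳ (b , B))) (openGaps m (Bs ∷ʳ (b , B))) ⟩
  length (Bs ∷ʳ (b , B)) + H + openGaps m (Bs ∷ʳ (b , B)) ∎
  where
  open ≡-Reasoning
  H = heightSumFrom (length (Bs ∷ʳ (b , B))) p
Reads-ddes bd st (solid {Bs} {m} {p} {w} r) = begin
  ddes (suc m ∷ w)                             ≡⟨ proj₂ (des-ddes-∷-Above ≤-refl (Reads⇒Above r)) ⟩
  ddes w                                       ≡⟨ Reads-ddes (All-≤-suc bd) st r ⟩
  H + openGaps (suc m) Bs                      ≡⟨ cong (H +_) (openGaps-suc Bs bd) ⟩
  H + (length Bs + openGaps m Bs)              ≡⟨ m+[n+o]≡n+m+o H (length Bs) (openGaps m Bs) ⟩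
  length Bs + H + openGaps m Bs                ∎
  where
  open ≡-Reasoning
  H = heightSumFrom (length Bs) p
Reads-ddes {m = m} bd@(b≤m ∷ bd′) st (down {Bs} {b} {B} {p = p} {w} r) = begin
  ddes (suc m ∷ b ∷ B ++ w)
    ≡⟨ ddes-descent (B ++ w) (s≤s b≤m) ⟩
  suc m ∸ b + ddes (b ∷ B ++ w)
    -- The unit split off here is the popped block's share in the height `suc (length Bs)` of the
    -- down-step.
    ≡⟨ cong₂ _+_ (+-∸-assoc 1 b≤m) (proj₂ (des-ddes-run (All.++⁻ˡ (b ∷ B) bd) (proj₁ (AllPairs-++⁻ (b ∷ B) st)) (Above-weaken (Reads⇒Above r)))) ⟩
  suc (m ∸ b) + ddes w
    ≡⟨ cong (suc (m ∸ b) +_) (Reads-ddes (Bounded-down {b = b} {B} Bs bd) (proj₂ (AllPairs-++⁻ (b ∷ B) st)) r) ⟩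
  suc (m ∸ b) + (H + openGaps (suc m) Bs)
    ≡⟨ cong (λ g → suc (m ∸ b) + (H + g)) (openGaps-suc Bs (All.++⁻ʳ B bd′)) ⟩
  suc (m ∸ b) + (H + (length Bs + openGaps m Bs))
    ≡⟨ rearrange (m ∸ b) H (length Bs) (openGaps m Bs) ⟩
  suc (length Bs) + H + (m ∸ b + openGaps m Bs) ∎
  where
  open ≡-Reasoning
  H = heightSumFrom (length Bs) p
  rearrange : ∀ x y z t → suc x + (y + (z + t)) ≡ suc z + y + (x + t)
  rearrange = solve-∀

-- Words avoiding 321

-- Avoids L m k w: after a prefix with maximum m whose missing values below m are L,
-- the word continues by w and has maximum m + k in the end.
data Avoids : List ℕ → ℕ → ℕ → List ℕ → Set
-- Here the next letter has to be a new maximum: once a value has been passed over, nothing may be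
-- popped before that maximum is written.
data AvoidsFromRecord : List ℕ → ℕ → ℕ → List ℕ → Set

data Avoids where
  done      : ∀ {m} → Avoids [] m 0 []
  pop       : ∀ {l L m k w} → Avoids L m k w → Avoids (l ∷ L) m k (l ∷ w)
  newRecord : ∀ {L m k w} → AvoidsFromRecord L m k w → Avoids L m k w

data AvoidsFromRecord where
  take : ∀ {L m k w} → Avoids L (suc m) k w → AvoidsFromRecord L m (suc k) (suc m ∷ w)
  skip : ∀ {L m k w} → AvoidsFromRecord (L ∷ʳ suc m) (suc m) k w → AvoidsFromRecord L m (suc k) w

pops : ∀ B {L m k w} → Avoids L m k w → Avoids (B ++ L) m k (B ++ w)
pops [] a = a
pops (b ∷ B) a = pop (pops B a)

Reads⇒Avoids : ∀ {Bs m p w} → Reads Bs m p w → Avoids (flatten Bs) m (length p) w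
Reads⇒AvoidsFromRecord : ∀ {Bs m s p w} → Reads Bs m (s ∷ p) w → AvoidsFromRecord (flatten Bs) m (suc (length p)) w
-- A nonempty queue excludes the empty path, so after a skip some step remains and the next letter
-- written is a new maximum.
Reads⇒AvoidsFromRecord-∷ʳ : ∀ {Bs B m p w} → Reads (Bs ∷ʳ B) m p w → AvoidsFromRecord (flatten (Bs ∷ʳ B)) m (length p) w

Reads⇒Avoids {p = []} end = done
Reads⇒Avoids {p = _ ∷ _} r = newRecord (Reads⇒AvoidsFromRecord r)

Reads⇒AvoidsFromRecord (up {Bs} {m} r) =
  skip (subst (λ L → AvoidsFromRecord L _ _ _) (flatten-∷ʳ Bs (suc m) []) (Reads⇒AvoidsFromRecord-∷ʳ r))
Reads⇒AvoidsFromRecord (broken {Bs} {b} {B} {m} r) =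
  skip (subst (λ L → AvoidsFromRecord L _ _ _) (flatten-extend Bs b B (suc m)) (Reads⇒AvoidsFromRecord-∷ʳ r))
Reads⇒AvoidsFromRecord (solid r) = take (Reads⇒Avoids r)
Reads⇒AvoidsFromRecord (down {b = b} {B} r) = take (pops (b ∷ B) (Reads⇒Avoids r))

Reads⇒AvoidsFromRecord-∷ʳ {Bs} {p = []} r = contradiction (emptyPath r) (∷ʳ≢[] Bs)
  where
  emptyPath : ∀ {Bs m w} → Reads Bs m [] w → Bs ≡ []
  emptyPath end = refl
Reads⇒AvoidsFromRecord-∷ʳ {p = _ ∷ _} r = Reads⇒AvoidsFromRecord r

-- Whether a queued value opened a block is only revealed when it is popped, so
-- the blocks are an output here, just as the path is.
Avoids⇒Reads : ∀ {L m k w} → Avoids L m k w →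
               ∃₂ λ B Bs → ∃₂ λ p v → L ≡ B ++ flatten Bs × w ≡ B ++ v × Reads Bs m p v × length p ≡ k
AvoidsFromRecord⇒Reads : ∀ {L m k w} → AvoidsFromRecord L m k w →
                         ∃₂ λ Bs p → L ≡ flatten Bs × Reads Bs m p w × length p ≡ k

Avoids⇒Reads done = [] , [] , [] , [] , refl , refl , end , refl
Avoids⇒Reads (pop {l} a) =
  let B , Bs , p , v , L≡ , w≡ , r , k≡ = Avoids⇒Reads a
  in l ∷ B , Bs , p , v , cong (l ∷_) L≡ , cong (l ∷_) w≡ , r , k≡
Avoids⇒Reads (newRecord a) =
  let Bs , p , L≡ , r , k≡ = AvoidsFromRecord⇒Reads a
  in [] , Bs , p , _ , L≡ , refl , r , k≡

AvoidsFromRecord⇒Reads (take a) with Avoids⇒Reads a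
-- The values popped right after the record `suc m` form the block that it releases: none gives
-- `solid`, some give `down`.
... | [] , Bs , p , v , L≡ , refl , r , k≡ = Bs , solid ∷ p , L≡ , solid r , cong suc k≡
... | b ∷ B , Bs , p , v , L≡ , refl , r , k≡ = (b , B) ∷ Bs , down ∷ p , L≡ , down r , cong suc k≡
AvoidsFromRecord⇒Reads (skip {L} {m} a) with AvoidsFromRecord⇒Reads a
... | Bs , p , L≡ , r , k≡ with initLast Bs
... | [] = contradiction L≡ (∷ʳ≢[] L)
-- The last queued value is `suc m`. It opened a block if it is alone in the last one, and extended
-- that block otherwise.
... | Bs′ ∷ʳ′ (b , B) with initLast B
... | [] with ∷ʳ-injective L (flatten Bs′) (≡.trans L≡ (flatten-∷ʳ Bs′ b []))
... | eq , refl = Bs′ , up ∷ p , eq , up r , cong suc k≡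
AvoidsFromRecord⇒Reads (skip {L} {m} a) | _ , p , L≡ , r , k≡ | Bs′ ∷ʳ′ (b , _) | B ∷ʳ′ x
  with ∷ʳ-injective L (flatten (Bs′ ∷ʳ (b , B))) (≡.trans L≡ (flatten-extend Bs′ b B x))
... | eq , refl = Bs′ ∷ʳ (b , B) , broken ∷ p , eq , broken r , cong suc k≡

range : ℕ → ℕ → List ℕ
range m zero = []
range m (suc k) = suc m ∷ range (suc m) k

length-range : ∀ m k → length (range m k) ≡ k
length-range m zero = refl
length-range m (suc k) = cong suc (length-range (suc m) k)

range-> : ∀ m k → All (m <_) (range m k)
range-> m zero = []
range-> m (suc k) = ≤-refl ∷ All.map <⇒≤ (range-> (suc m) k)

range-≤ : ∀ m k → All (_≤ m + k) (range m k)
range-≤ m zero = []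
range-≤ m (suc k) rewrite +-suc m k = s≤s (m≤m+n m k) ∷ range-≤ (suc m) k

range-sorted : ∀ m k → AllPairs _<_ (range m k)
range-sorted m zero = []
range-sorted m (suc k) = range-> (suc m) k ∷ range-sorted (suc m) k

∈-range : ∀ {x} m k → m < x → x ≤ m + k → x ∈ range m k
∈-range m zero m<x x≤ = contradiction (≤-trans x≤ (≤-reflexive (+-identityʳ m))) (<⇒≱ m<x)
∈-range {x} m (suc k) m<x x≤ with x ≟ suc m
... | yes refl = here refl
... | no x≢ = there (∈-range (suc m) k (≤∧≢⇒< m<x (≢-sym x≢)) (≤-trans x≤ (≤-reflexive (+-suc m k))))

Avoids⇒↭ : ∀ {L m k w} → Avoids L m k w → w ↭ L ++ range m k
AvoidsFromRecord⇒↭ : ∀ {L m k w} → AvoidsFromRecord L m k w → w ↭ L ++ range m k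
Avoids⇒↭ done = refl
Avoids⇒↭ (pop a) = prep _ (Avoids⇒↭ a)
Avoids⇒↭ (newRecord a) = AvoidsFromRecord⇒↭ a
AvoidsFromRecord⇒↭ (take {L} {m} {k} a) = trans (prep _ (Avoids⇒↭ a)) (↭-sym (shift (suc m) L (range (suc m) k)))
AvoidsFromRecord⇒↭ (skip {L} {m} {k} a) = trans (AvoidsFromRecord⇒↭ a) (↭-reflexive (∷ʳ-++ L (suc m) (range (suc m) k)))

-- Inversions against excedances

countLess-++ : ∀ x xs ys → countLess x (xs ++ ys) ≡ countLess x xs + countLess x ys
countLess-++ x [] ys = refl
countLess-++ x (y ∷ xs) ys =
  ≡.trans (cong (_ +_) (countLess-++ x xs ys)) (sym (+-assoc _ (countLess x xs) (countLess x ys)))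

countLess-↭ : ∀ x {xs ys} → xs ↭ ys → countLess x xs ≡ countLess x ys
countLess-↭ x refl = refl
countLess-↭ x (prep y p) = cong (_ +_) (countLess-↭ x p)
countLess-↭ x (swap {xs} {ys} y z p) = begin
  a + (b + countLess x xs)   ≡⟨ +-assoc a b _ ⟨
  a + b + countLess x xs     ≡⟨ cong₂ _+_ (+-comm a b) (countLess-↭ x p) ⟩
  b + a + countLess x ys     ≡⟨ +-assoc b a _ ⟩
  b + (a + countLess x ys)   ∎
  where
  open ≡-Reasoning
  a = if y <ᵇ x then 1 else 0
  b = if z <ᵇ x then 1 else 0
countLess-↭ x (trans p q) = ≡.trans (countLess-↭ x p) (countLess-↭ x q)

countLess-all : ∀ {x xs} → All (_< x) xs → countLess x xs ≡ length xs
countLess-all [] = refl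
countLess-all (y<x ∷ ys<x) rewrite <ᵇ-true y<x = cong suc (countLess-all ys<x)

countLess-none : ∀ {x xs} → All (x ≤_) xs → countLess x xs ≡ 0
countLess-none [] = refl
countLess-none (x≤y ∷ x≤ys) rewrite <ᵇ-false x≤y = countLess-none x≤ys

excess : ℕ → ℕ → ℕ → ℕ
excess n i x = if (i <ᵇ n) ∧ (i <ᵇ x) then x ∸ i else 0

excess≤∸ : ∀ n i x → excess n i x ≤ x ∸ i
excess≤∸ n i x with (i <ᵇ n) ∧ (i <ᵇ x)
... | true = ≤-refl
... | false = z≤n

excess≡∸ : ∀ {n x} i → x ≤ n → excess n i x ≡ x ∸ i
excess≡∸ {n} {x} i x≤n with i <? x
... | yes i<x rewrite <ᵇ-true (≤-trans i<x x≤n) | <ᵇ-true i<x = refl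
... | no i≮x rewrite <ᵇ-false (≮⇒≥ i≮x) | m≤n⇒m∸n≡0 (≮⇒≥ i≮x) with i <ᵇ n
... | true = refl
... | false = refl

AllPairs-remove : ∀ {R : ℕ → ℕ → Set} xs {y ys} → AllPairs R (xs ++ y ∷ ys) →
                  All (λ x → R x y) xs × All (R y) ys × AllPairs R (xs ++ ys)
AllPairs-remove [] (r ∷ rs) = [] , r , rs
AllPairs-remove (x ∷ xs) (r ∷ rs) with All.++⁻ʳ xs r | AllPairs-remove xs rs
... | xRy ∷ xRys | xsRy , yRys , rs′ = xRy ∷ xsRy , yRys , All.++⁺ (All.++⁻ˡ xs r) xRys ∷ rs′

-- Entries grow by at least one each time, so the last is at least `x + length L`.
sorted-bound : ∀ {m x} L → All (x <_) L → AllPairs _<_ L → All (_< m) (x ∷ L) → x + length L < m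
sorted-bound {x = x} [] _ _ (x<m ∷ []) = ≤-trans (s≤s (≤-reflexive (+-identityʳ x))) x<m
sorted-bound {x = x} (y ∷ L) (x<y ∷ _) (y< ∷ L<) (_ ∷ L<m) =
  ≤-trans (s≤s (≤-trans (≤-reflexive (+-suc x (length L))) (+-monoˡ-≤ (length L) x<y))) (sorted-bound L y< L< L<m)

-- As for Avoids, with w starting at position i, but without any restriction on
-- the order of the letters of w.
record State (L : List ℕ) (m k i : ℕ) (w : List ℕ) : Set where
  constructor state
  field
    sorted : AllPairs _<_ L
    -- The values up to `m` are the `i - 1` letters written before position `i` together with those
    -- of `L`.
    size   : i + length L ≡ suc m
    perm   : w ↭ L ++ range m k
open State

State-pop : ∀ L₁ {L₂ m k i x w} → State (L₁ ++ x ∷ L₂) m k i (x ∷ w) → State (L₁ ++ L₂) m k (suc i) w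
State-pop L₁ {L₂} {m} {k} {i} {x} (state st sz pm) = state
  (proj₂ (proj₂ (AllPairs-remove L₁ st)))
  (≡.trans (sym (+-suc i _)) (≡.trans (cong (i +_) (sym (length-++-sucʳ L₁ x L₂))) sz))
  (drop-∷ (trans pm (trans (↭-reflexive (++-assoc L₁ (x ∷ L₂) (range m k)))
    (trans (shift x L₁ (L₂ ++ range m k)) (prep x (↭-reflexive (sym (++-assoc L₁ L₂ (range m k)))))))))

State-take : ∀ {L m k i w} → State L m (suc k) i (suc m ∷ w) → State L (suc m) k (suc i) w
State-take {L} {m} {k} (state st sz pm) = state st (cong suc sz) (drop-∷ (trans pm (shift (suc m) L (range (suc m) k))))

State-skip : ∀ {L m k i w} → All (_≤ m) L → State L m (suc k) i w → State (L ∷ʳ suc m) (suc m) k i w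
State-skip {L} {m} {k} {i} L≤ (state st sz pm) = state (∷ʳ-sorted L≤ st)
  (≡.trans (cong (i +_) (length-∷ʳ L (suc m))) (≡.trans (+-suc i (length L)) (cong suc sz)))
  (trans pm (↭-reflexive (sym (∷ʳ-++ L (suc m) (range (suc m) k)))))

-- Still to come are the rest of `L` and values above `m`; as `L` is sorted, those below `x` are
-- exactly `L₁`.
countLess-pop : ∀ L₁ {L₂ m k i x w} → All (_< m) (L₁ ++ x ∷ L₂) → State (L₁ ++ x ∷ L₂) m k i (x ∷ w) →
                countLess x w ≡ length L₁
countLess-pop L₁ {L₂} {m} {k} {i} {x} {w} L<m s
  with AllPairs-remove L₁ (sorted s) | All.++⁻ʳ L₁ L<m
... | L₁<x , x<L₂ , _ | x<m ∷ _ = begin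
  countLess x w                                        ≡⟨ countLess-↭ x (perm (State-pop L₁ s)) ⟩
  countLess x ((L₁ ++ L₂) ++ range m k)                ≡⟨ cong (countLess x) (++-assoc L₁ L₂ (range m k)) ⟩
  countLess x (L₁ ++ L₂ ++ range m k)                  ≡⟨ countLess-++ x L₁ _ ⟩
  countLess x L₁ + countLess x (L₂ ++ range m k)       ≡⟨ cong₂ _+_ (countLess-all L₁<x) (countLess-none
                                                            (All.++⁺ (All.map <⇒≤ x<L₂) (All.map (λ m<y → <⇒≤ (<-trans x<m m<y)) (range-> m k)))) ⟩
  length L₁ + 0                                        ≡⟨ +-identityʳ _ ⟩
  length L₁                                            ∎
  where open ≡-Reasoning

-- By `size`, `m` is `i + length L₁ + length L₂`, and `L₂` lies strictly between `x` and `m`, so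
-- `x < i + length L₁`. The predecessor keeps the bound strictly below the inversion count
-- `length L₁` unless `L₁` is empty.
excess-pop : ∀ n L₁ {L₂ m k i x w} → All (_< m) (L₁ ++ x ∷ L₂) → State (L₁ ++ x ∷ L₂) m k i (x ∷ w) →
             excess n i x ≤ pred (length L₁)
excess-pop n L₁ {L₂} {m} {k} {i} {x} L<m s = ≤-trans (excess≤∸ n i x) (m≤n+o⇒m∸n≤o x i (below (length L₁) bound))
  where
  open ≤-Reasoning
  rearrange : ∀ i a b → i + suc (a + b) ≡ suc (i + a + b)
  rearrange = solve-∀
  bound : x < i + length L₁
  bound = +-cancelʳ-< (length L₂) x (i + length L₁) (begin-strict
    x + length L₂
      <⟨ sorted-bound L₂ (proj₁ (proj₂ (AllPairs-remove L₁ (sorted s))))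
           (AllPairs.tail (proj₂ (AllPairs-++⁻ L₁ (sorted s)))) (All.++⁻ʳ L₁ L<m) ⟩
    m
      ≡⟨ suc-injective (≡.trans (sym (size s)) (≡.trans (cong (i +_) (≡.trans (length-++-sucʳ L₁ x L₂) (cong suc (length-++ L₁)))) (rearrange i _ (length L₂)))) ⟩
    i + length L₁ + length L₂ ∎)
  below : ∀ l → x < i + l → x ≤ i + pred l
  below zero x<i = <⇒≤ x<i
  below (suc l) x<i+l = ≤-pred (≤-trans x<i+l (≤-reflexive (+-suc i l)))

countLess-take : ∀ {L m k i w} → All (_≤ m) L → State L m (suc k) i (suc m ∷ w) → countLess (suc m) w ≡ length L
countLess-take {L} {m} {k} {i} {w} L≤ s = begin
  countLess (suc m) w                                             ≡⟨ countLess-↭ (suc m) (perm (State-take s)) ⟩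
  countLess (suc m) (L ++ range (suc m) k)                        ≡⟨ countLess-++ (suc m) L _ ⟩
  countLess (suc m) L + countLess (suc m) (range (suc m) k)       ≡⟨ cong₂ _+_ (countLess-all (All.map s≤s L≤)) (countLess-none (All.map <⇒≤ (range-> (suc m) k))) ⟩
  length L + 0                                                    ≡⟨ +-identityʳ _ ⟩
  length L                                                        ∎
  where open ≡-Reasoning

-- By `size`, `suc m ∸ i` counts the missing values. With `countLess-take`, a record adds equally to
-- `inv` and `dexc`.
excess-take : ∀ {n L m k i w} → m + suc k ≡ n → State L m (suc k) i (suc m ∷ w) → excess n i (suc m) ≡ length L
excess-take {n} {L} {m} {k} {i} refl s = begin
  excess n i (suc m)       ≡⟨ excess≡∸ i (≤-trans (s≤s (m≤m+n m k)) (≤-reflexive (sym (+-suc m k)))) ⟩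
  suc m ∸ i                ≡⟨ cong (_∸ i) (size s) ⟨
  i + length L ∸ i         ≡⟨ m+n∸m≡n i (length L) ⟩
  length L                 ∎
  where open ≡-Reasoning

sum-tight : ∀ {a a′ b b′} → a′ ≤ a → b′ ≤ b → a + b ≡ a′ + b′ → a ≤ a′ × b ≡ b′
sum-tight {a} {a′} {b} {b′} a′≤a b′≤b eq =
  +-cancelʳ-≤ b a a′ (≤-trans (≤-reflexive eq) (+-monoʳ-≤ a′ b′≤b)) ,
  ≤-antisym (+-cancelˡ-≤ a b b′ (≤-trans (≤-reflexive eq) (+-monoˡ-≤ b′ a′≤a))) b′≤b

-- The equality case shares the induction with the inequality: equal sums give equality for the tail
-- only because both head and tail are already bounded. `All (_< m) L` says that `m` itself is not
-- missing.
dexc≤inv : ∀ {n L m k i} w → m + k ≡ n → All (_< m) L → State L m k i w →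
           dexcFrom n i w ≤ inv w × (inv w ≡ dexcFrom n i w → Avoids L m k w)
-- Values below the new maximum `x` move into `L` one at a time while the word stays as it is, so
-- `x` is charged only at `take`. The bound is `_≤ m` because `m` may be among the values just
-- skipped.
dexc≤inv-record : ∀ {n L m k i} x w → m + k ≡ n → All (_≤ m) L → State L m k i (x ∷ w) → x ∈ range m k →
                  dexcFrom n i (x ∷ w) ≤ inv (x ∷ w) ×
                  (inv (x ∷ w) ≡ dexcFrom n i (x ∷ w) → AvoidsFromRecord L m k (x ∷ w))

dexc≤inv {L = L} {m} {k} [] eq L< s with L | k | ↭-empty-inv (↭-sym (perm s))
... | [] | zero | _ = z≤n , λ _ → done
dexc≤inv {n} {L} {m} {k} {i} (x ∷ w) eq L< s with ∈-++⁻ L (∈-resp-↭ (perm s) (here refl))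
... | inj₂ x∈ = let le , av = dexc≤inv-record x w eq (All.map <⇒≤ L<) s x∈ in le , λ e → newRecord (av e)
... | inj₁ x∈ with ∈-∃++ x∈
... | L₁ , L₂ , refl = +-mono-≤ head≤ (proj₁ ih) , tight
  where
  ih = dexc≤inv w eq (All.++⁺ (All.++⁻ˡ L₁ L<) (All.tail (All.++⁻ʳ L₁ L<))) (State-pop L₁ s)
  count≡ = countLess-pop L₁ L< s
  head≤pred = excess-pop n L₁ L< s
  head≤ : excess n i x ≤ countLess x w
  head≤ = ≤-trans head≤pred (≤-trans (pred[n]≤n {length L₁}) (≤-reflexive (sym count≡)))
  -- Equality yields `length L₁ ≤ pred (length L₁)`, which leaves only the empty `L₁`: `x` is the
  -- smallest missing value.
  popFirst : ∀ L₁ → length L₁ ≤ pred (length L₁) → Avoids (L₁ ++ L₂) m k w → Avoids (L₁ ++ x ∷ L₂) m k (x ∷ w)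
  popFirst [] _ a = pop a
  popFirst (_ ∷ L₁) l<l _ = contradiction l<l (<-irrefl refl)
  tight : inv (x ∷ w) ≡ dexcFrom n i (x ∷ w) → Avoids (L₁ ++ x ∷ L₂) m k (x ∷ w)
  tight e = let count≤ , e′ = sum-tight head≤ (proj₁ ih) e in
    popFirst L₁ (≤-trans (≤-reflexive (sym count≡)) (≤-trans count≤ head≤pred)) (proj₂ ih e′)

dexc≤inv-record {k = suc k} _ w eq L≤ s (here refl) =
  let le , av = dexc≤inv w (≡.trans (sym (+-suc _ k)) eq) (All.map s≤s L≤) (State-take s)
      head≡ = ≡.trans (excess-take eq s) (sym (countLess-take L≤ s))
  in +-mono-≤ (≤-reflexive head≡) le , λ e → take (av (proj₂ (sum-tight (≤-reflexive head≡) le e)))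
dexc≤inv-record {k = suc k} x w eq L≤ s (there x∈) =
  let le , av = dexc≤inv-record x w (≡.trans (sym (+-suc _ k)) eq) (All.∷ʳ⁺ (All-≤-suc L≤) ≤-refl) (State-skip L≤ s) x∈
  in le , λ e → skip (av e)

Avoids⇒inv≡dexc : ∀ {n L m k i w} → m + k ≡ n → All (_< m) L → State L m k i w → Avoids L m k w →
                  inv w ≡ dexcFrom n i w
AvoidsFromRecord⇒inv≡dexc : ∀ {n L m k i w} → m + k ≡ n → All (_≤ m) L → State L m k i w → AvoidsFromRecord L m k w →
                            inv w ≡ dexcFrom n i w
Avoids⇒inv≡dexc eq L< s done = refl
Avoids⇒inv≡dexc {n} eq L< s (pop a) =
  -- For the smallest missing value the bound of `excess-pop` is `pred 0`, which is 0.
  cong₂ _+_ (≡.trans (countLess-pop [] L< s) (sym (n≤0⇒n≡0 (excess-pop n [] L< s))))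
            (Avoids⇒inv≡dexc eq (All.tail L<) (State-pop [] s) a)
Avoids⇒inv≡dexc eq L< s (newRecord a) = AvoidsFromRecord⇒inv≡dexc eq (All.map <⇒≤ L<) s a
AvoidsFromRecord⇒inv≡dexc eq L≤ s (take {k = k} a) =
  cong₂ _+_ (≡.trans (countLess-take L≤ s) (sym (excess-take eq s)))
            (Avoids⇒inv≡dexc (≡.trans (sym (+-suc _ k)) eq) (All.map s≤s L≤) (State-take s) a)
AvoidsFromRecord⇒inv≡dexc eq L≤ s (skip {k = k} a) =
  AvoidsFromRecord⇒inv≡dexc (≡.trans (sym (+-suc _ k)) eq) (All.∷ʳ⁺ (All-≤-suc L≤) ≤-refl) (State-skip L≤ s) a

-- Boolean predicates and permutations of 1 to n

T-∧⁻ : ∀ x {y} → T (x ∧ y) → T x × T y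
T-∧⁻ x = Equivalence.to (T-∧ {x})

T-∧⁺ : ∀ {x y} → T x → T y → T (x ∧ y)
T-∧⁺ tx ty = Equivalence.from T-∧ (tx , ty)

T-not⁻ : ∀ {b} → T (not b) → ¬ T b
T-not⁻ {false} _ ()

T-not⁺ : ∀ {b} → ¬ T b → T (not b)
T-not⁺ {false} _ = _
T-not⁺ {true} ¬t = ¬t _

distinct⇒Unique : ∀ w → T (distinct w) → Unique w
distinct⇒Unique [] _ = []
distinct⇒Unique (x ∷ w) t =
  let x∉w , dw = T-∧⁻ (not (any (x ≡ᵇ_) w)) t
  in All.tabulate (λ {y} y∈w x≡y → T-not⁻ {any (x ≡ᵇ_) w} x∉w (any⁺ (x ≡ᵇ_) (Any.map (λ { refl → ≡⇒≡ᵇ x y x≡y }) y∈w)))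
     ∷ distinct⇒Unique w dw

Unique⇒distinct : ∀ {w} → Unique w → T (distinct w)
Unique⇒distinct [] = _
Unique⇒distinct {x ∷ w} (x∉w ∷ uw) =
  T-∧⁺ (T-not⁺ {any (x ≡ᵇ_) w} λ t → All.All¬⇒¬Any x∉w (Any.map (≡ᵇ⇒≡ x _) (any⁻ (x ≡ᵇ_) w t))) (Unique⇒distinct uw)

-- Removing the head from `U` keeps all other letters of `w`, which differ from it by distinctness;
-- equal lengths make both lists run out together.
Unique-⊆⇒↭ : ∀ {w U : List ℕ} → Unique w → All (_∈ U) w → length w ≡ length U → w ↭ U
Unique-⊆⇒↭ {U = []} [] _ _ = refl
Unique-⊆⇒↭ {x ∷ w} (x∉w ∷ uw) (x∈U ∷ w⊆U) eq with ∈-∃++ x∈U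
... | U₁ , U₂ , refl =
  trans (prep x (Unique-⊆⇒↭ uw (All.zipWith (λ (x≢y , y∈U) → avoid x≢y y∈U) (x∉w , w⊆U))
                  (suc-injective (≡.trans eq (length-++-sucʳ U₁ x U₂)))))
        (↭-sym (shift x U₁ U₂))
  where
  avoid : ∀ {y : ℕ} → x ≢ y → y ∈ U₁ ++ x ∷ U₂ → y ∈ U₁ ++ U₂
  avoid x≢y y∈U with ∈-++⁻ U₁ y∈U
  ... | inj₁ y∈U₁ = ∈-++⁺ˡ y∈U₁
  ... | inj₂ (here y≡x) = contradiction (sym y≡x) x≢y
  ... | inj₂ (there y∈U₂) = ∈-++⁺ʳ U₁ y∈U₂

isPerm⇒↭ : ∀ n w → T (isPerm n w) → w ↭ range 0 n
isPerm⇒↭ n w t =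
  let len , t′ = T-∧⁻ (length w ≡ᵇ n) t
      bounds , dist = T-∧⁻ (inRange n w) t′
  in Unique-⊆⇒↭ (distinct⇒Unique w dist)
       (All.map (λ {x} b → let 1≤x , x≤n = T-∧⁻ (1 ≤ᵇ x) b in ∈-range 0 n (≤ᵇ⇒≤ 1 x 1≤x) (≤ᵇ⇒≤ x n x≤n)) (All.all⁺ _ w bounds))
       (≡.trans (≡ᵇ⇒≡ (length w) n len) (sym (length-range 0 n)))

↭⇒isPerm : ∀ n {w} → w ↭ range 0 n → T (isPerm n w)
↭⇒isPerm n {w} p =
  T-∧⁺ (≡⇒≡ᵇ (length w) n (≡.trans (↭-length p) (length-range 0 n)))
    (T-∧⁺ (All.all⁻ (λ x → (1 ≤ᵇ x) ∧ (x ≤ᵇ n)) (All-resp-↭ (↭-sym p) (All.zipWith (λ {x} (0<x , x≤n) → T-∧⁺ {1 ≤ᵇ x} {x ≤ᵇ n} (≤⇒≤ᵇ 0<x) (≤⇒≤ᵇ x≤n)) (range-> 0 n , range-≤ 0 n))))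
          (Unique⇒distinct (Unique-resp-↭ (↭⇒↭ₛ (↭-sym p)) (AllPairs.map <⇒≢ (range-sorted 0 n)))))

-- The bijection

Encodes : List Step → List ℕ → Set
Encodes = Reads [] 0

biInc⇒Encodes : ∀ n d k w → T (biIncPermPred n d k w) → ∃ λ p → Encodes p w
biInc⇒Encodes n d k w t with T-∧⁻ (isPerm n w) t
... | isP , t′ with T-∧⁻ (isBiIncreasing w) t′
... | isB , _ with isPerm⇒↭ n w isP
-- Before the first letter nothing is missing, the maximum is 0 and the position is 1.
... | p with Avoids⇒Reads (proj₂ (dexc≤inv {L = []} w refl [] (state [] refl p))
    (subst (λ l → inv w ≡ dexcFrom l 1 w) (≡.trans (↭-length p) (length-range 0 n)) (≡ᵇ⇒≡ (inv w) (dexc w) isB)))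
-- As nothing is missing, there are neither leading pops nor queued blocks.
... | [] , [] , q , _ , _ , refl , r , _ = q , r

motzkin⇒Encodes : ∀ n d k p → T (motzkinPred n d k p) → ∃ λ w → Encodes p w
motzkin⇒Encodes n d k p t =
  let _ , t₁ = T-∧⁻ (length p ≡ᵇ n) t
      v , t₂ = T-∧⁻ (isMotzkin2 p) t₁
      _ , t₃ = T-∧⁻ (numUp p ≡ᵇ d) t₂
      nb , _ = T-∧⁻ (noBrokenAt0From 0 p) t₃
  in path⇒Reads [] 0 p refl v nb

Encodes-des : ∀ {p w} → Encodes p w → des w ≡ numUp p
Encodes-des {p} r = ≡.trans (Reads-des [] [] r) (+-identityʳ (numUp p))

Encodes-ddes : ∀ {p w} → Encodes p w → ddes w ≡ heightSum p
Encodes-ddes {p} r = ≡.trans (Reads-ddes [] [] r) (+-identityʳ (heightSum p))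

Encodes-↭ : ∀ {p w} → Encodes p w → w ↭ range 0 (length p)
Encodes-↭ r = Avoids⇒↭ (Reads⇒Avoids r)

Encodes-length : ∀ {p w} → Encodes p w → length w ≡ length p
Encodes-length {p} r = ≡.trans (↭-length (Encodes-↭ r)) (length-range 0 (length p))

Encodes⇒biInc : ∀ n d k {p w} → Encodes p w → T (motzkinPred n d k p) → T (biIncPermPred n d k w)
Encodes⇒biInc n d k {p} {w} r t =
  let len , t₁ = T-∧⁻ (length p ≡ᵇ n) t
      _ , t₂ = T-∧⁻ (isMotzkin2 p) t₁
      ups , t₃ = T-∧⁻ (numUp p ≡ᵇ d) t₂
      _ , hs = T-∧⁻ (noBrokenAt0From 0 p) t₃
      bi = Avoids⇒inv≡dexc refl [] (state [] refl (Encodes-↭ r)) (Reads⇒Avoids r)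
  in T-∧⁺ (↭⇒isPerm n (subst (λ l → w ↭ range 0 l) (≡ᵇ⇒≡ (length p) n len) (Encodes-↭ r)))
    (T-∧⁺ (≡⇒≡ᵇ (inv w) (dexc w) (subst (λ l → inv w ≡ dexcFrom l 1 w) (sym (Encodes-length r)) bi))
    (T-∧⁺ (subst (λ e → T (e ≡ᵇ d)) (sym (Encodes-des r)) ups)
          (subst (λ e → T (e ≡ᵇ k)) (sym (Encodes-ddes r)) hs)))

Encodes⇒motzkin : ∀ n d k {p w} → Encodes p w → T (biIncPermPred n d k w) → T (motzkinPred n d k p)
Encodes⇒motzkin n d k {p} {w} r t =
  let isP , t₁ = T-∧⁻ (isPerm n w) t
      len , _ = T-∧⁻ (length w ≡ᵇ n) isP
      _ , t₂ = T-∧⁻ (isBiIncreasing w) t₁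
      ds , dds = T-∧⁻ (des w ≡ᵇ d) t₂
      v , nb = Reads⇒path refl r
  in T-∧⁺ (subst (λ l → T (l ≡ᵇ n)) (Encodes-length r) len)
    (T-∧⁺ v
    (T-∧⁺ (subst (λ e → T (e ≡ᵇ d)) (Encodes-des r) ds)
    (T-∧⁺ nb (subst (λ e → T (e ≡ᵇ k)) (Encodes-ddes r) dds))))

Σ-T-≡ : ∀ {A : Set} {P : A → Bool} {x y : A} {px : T (P x)} {py : T (P y)} →
        x ≡ y → _≡_ {A = Σ A (λ z → T (P z))} (x , px) (y , py)
Σ-T-≡ refl = cong (_ ,_) (T-irrelevant _ _)

theorem4p8 : (n d k : ℕ) → n ≥ 1 →
    Σ (List ℕ) (λ w → T (biIncPermPred n d k w))
    ↔ Σ (List Step) (λ p → T (motzkinPred n d k p))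
theorem4p8 n d k _ = mk↔ₛ′ to from to∘from from∘to
  where
  Perm = Σ (List ℕ) (λ w → T (biIncPermPred n d k w))
  Path = Σ (List Step) (λ p → T (motzkinPred n d k p))

  to : Perm → Path
  to (w , t) = let p , r = biInc⇒Encodes n d k w t in p , Encodes⇒motzkin n d k r t

  from : Path → Perm
  from (p , t) = let w , r = motzkin⇒Encodes n d k p t in w , Encodes⇒biInc n d k r t

  to∘from : ∀ q → to (from q) ≡ q
  -- The given path and the recovered one both encode the same word.
  to∘from q@(p , t) = Σ-T-≡ {P = motzkinPred n d k} (proj₁ (Reads-injective [] refl
    (proj₂ (biInc⇒Encodes n d k (proj₁ (from q)) (proj₂ (from q)))) (proj₂ (motzkin⇒Encodes n d k p t)) refl))

  from∘to : ∀ q → from (to q) ≡ q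
  from∘to q@(w , t) = Σ-T-≡ {P = biIncPermPred n d k} (Reads-functional
    (proj₂ (motzkin⇒Encodes n d k (proj₁ (to q)) (proj₂ (to q)))) (proj₂ (biInc⇒Encodes n d k w t)))
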